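{- Let $S_A$ be a memory, $M$ a term, $\vec I$ a memory type and $n$ a natural number such that $\vdash_{w,n}(S_A,M,\varepsilon):\varepsilon\Rightarrow\vec I$ (a weak typing derivation of weight $n$ for the machine state). Then there exist a memory $T_A$ and natural numbers $m,k$ such that $\vdash_{w,m}T_A:\vec I$, $\;S_A,M\Downarrow_k T_A$, and $n=m+k$.
   Context: **Terms.** Fix a finite set $A$ of locations containing a default location $\lambda$, and infinitely many variables. Terms: $M,N,P ::= x \mid a\langle x\rangle.M \mid [N]a.M \mid \star \mid M;N$ (variable; abstraction/pop on $a\in A$, binding $x$ in $M$; application/push of $N$ on $a\in A$; unit; sequencing), taken up to $\alpha$-equivalence. $\{N/x\}M$ is capture-avoiding substitution. **Memories and states.** A stack is a finite sequence of terms, with head (top) on the right; a memory $S_A=\{S_a\mid a\in A\}$ is a family of stacks; $S_A\cdot N_a$ is $S_A$ with $N$ pushed on top of stack $a$; $\varepsilon_A$ is the memory with all stacks empty. A continuation stack is $K::=\varepsilon\mid M\,K$. A state is a triple $(S_A,M,K)$. **Evaluation.** $S_A,M\Downarrow_n T_A$ is defined inductively: $S_A,\star\Downarrow_1 S_A$; if $R_A,M\Downarrow_m S_A$ and $S_A,N\Downarrow_n T_A$ then $R_A,(M;N)\Downarrow_{m+n+1}T_A$; if $S_A\cdot N_a,\,M\Downarrow_n T_A$ then $S_A,\,[N]a.M\Downarrow_{n+1}T_A$; if $S_A,\,\{N/x\}M\Downarrow_n T_A$ then $S_A\cdot N_a,\ a\langle x\rangle.M\Downarrow_{n+1}T_A$.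 **Types.** Mutually inductively: computation types $\tau::=\vec I\Rightarrow\vec K$ with $\vec I,\vec K$ memory types; collection types $\iota::=[\tau_1,\dots,\tau_n]$ ($n\ge0$), finite multisets of computation types, with multiset union $\iota+\kappa$; vector types, finite sequences of collection types (last entry = top of stack); memory types, families of vector types indexed by $A$, with $\varepsilon$ the family of empty vectors. $\vec K\cdot\iota_a$ is $\vec K$ with $\iota$ added on top at location $a$. A typing context $\Gamma$ is a finitely supported function from variables to collection types (default value $[]$); $\Gamma+\Delta$ is the pointwise sum; in $\Gamma,x:\iota$ it is understood that $\Gamma(x)=[]$. An omitted context is the everywhere-$[]$ context. **Weak typing of terms** $\Gamma\vdash_w M:\tau$ and $\Gamma\vdash_w M:\iota$: (variable) $x:[\tau]\vdash x:\tau$; (abstraction) from $\Gamma,x:\iota\vdash M:\vec K\Rightarrow\vec L$ infer $\Gamma\vdash a\langle x\rangle.M:\vec K\cdot\iota_a\Rightarrow\vec L$; (application) from $\Gamma\vdash N:\iota$ and $\Delta\vdash M:\vec K\cdot\iota_a\Rightarrow\vec L$ infer $\Gamma+\Delta\vdash[N]a.M:\vec K\Rightarrow\vec L$; (unit) $\vdash\star:\vec I\Rightarrow\vec I$; (sequencing) from $\Gamma\vdash N:\vec I\Rightarrow\vec K$ and $\Delta\vdash M:\vec K\Rightarrow\vec L$ infer $\Gamma+\Delta\vdash N;M:\vec I\Rightarrow\vec L$; (collection) from $\Gamma_i\vdash M:\tau_i$ for $1\le i\le n$ ($n\ge0$) infer $\Gamma_1+\dots+\Gamma_n\vdash M:[\tau_1,\dots,\tau_n]$.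 **Weak typing of memories, continuation stacks, states:** $\vdash\varepsilon_A:\varepsilon$; from $\vdash S_A:\vec I$ and $\vdash M:\kappa$ infer $\vdash S_A\cdot M_a:\vec I\cdot\kappa_a$; $\vdash\varepsilon:\vec I\Rightarrow\vec I$ for the empty continuation stack; from $\vdash M:\vec I\Rightarrow\vec K$ and $\vdash K:\vec K\Rightarrow\vec L$ infer $\vdash M\,K:\vec I\Rightarrow\vec L$; from $\vdash S_A:\vec I$, $\vdash M:\vec I\Rightarrow\vec K$, $\vdash K:\vec K\Rightarrow\vec L$ infer $\vdash(S_A,M,K):\varepsilon\Rightarrow\vec L$. **Weight.** The weight of a derivation is the number of instances in it of the abstraction, application, sequencing and unit rules for terms (the other rules count zero); $\vdash_{w,n}$ means derivable with weight $n$. -}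

module Defs where

open import Data.Fin using (Fin; zero; suc)
open import Data.List using (List; []; _∷_; _++_)
open import Data.List.Relation.Binary.Permutation.Homogeneous using (Permutation)
import Data.List.Relation.Binary.Pointwise as List
open import Data.Nat using (ℕ; suc; _+_)
open import Data.Product using (Σ-syntax; _×_; _,_)
open import Data.Vec using (Vec; []; _∷_; replicate; updateAt; zipWith; _[_]≔_)
import Data.Vec.Relation.Binary.Pointwise.Inductive as Vec
open import Relation.Binary.PropositionalEquality using (_≡_)

-- A finite set of locations with a distinguished element is, up to renaming,
-- Fin (suc k) with zero distinguished.
module Machine (k : ℕ) where

  Loc : Set
  Loc = Fin (suc k)

  defaultLoc : Loc
  defaultLoc = zero

  -- Terms up to α-equivalence: well-scoped de Bruijn terms whose free
  -- variables are among v variables.  Terms are not assumed closed.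
  data Term (v : ℕ) : Set where
    var : Fin v → Term v
    abs : Loc → Term (suc v) → Term v            -- a⟨x⟩.M
    app : Term v → Loc → Term v → Term v         -- [N]a.M
    ⋆   : Term v
    _⨾_ : Term v → Term v → Term v

  Ren : ℕ → ℕ → Set
  Ren v w = Fin v → Fin w

  liftRen : ∀ {v w} → Ren v w → Ren (suc v) (suc w)
  liftRen ρ zero    = zero
  liftRen ρ (suc x) = suc (ρ x)

  rename : ∀ {v w} → Ren v w → Term v → Term w
  rename ρ (var x)     = var (ρ x)
  rename ρ (abs a M)   = abs a (rename (liftRen ρ) M)
  rename ρ (app N a M) = app (rename ρ N) a (rename ρ M)
  rename ρ ⋆           = ⋆
  rename ρ (M ⨾ N)     = rename ρ M ⨾ rename ρ N

  Sub : ℕ → ℕ → Set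
  Sub v w = Fin v → Term w

  liftSub : ∀ {v w} → Sub v w → Sub (suc v) (suc w)
  liftSub σ zero    = var zero
  liftSub σ (suc x) = rename suc (σ x)

  subst : ∀ {v w} → Sub v w → Term v → Term w
  subst σ (var x)     = σ x
  subst σ (abs a M)   = abs a (subst (liftSub σ) M)
  subst σ (app N a M) = app (subst σ N) a (subst σ M)
  subst σ ⋆           = ⋆
  subst σ (M ⨾ N)     = subst σ M ⨾ subst σ N

  single : ∀ {v} → Term v → Sub (suc v) v
  single N zero    = N
  single N (suc x) = var x

  -- {N/x}M, with x the most recently bound variable of M
  ⟪_⟫_ : ∀ {v} → Term v → Term (suc v) → Term v
  ⟪ N ⟫ M = subst (single N) M

  -- A family of stacks indexed by locations.  The top of a stack (and of a
  -- vector type) is the head of the list.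
  Family : Set → Set
  Family X = Vec (List X) (suc k)

  ε : ∀ {X} → Family X
  ε = replicate (suc k) []

  -- S ∙ N ＠ a pushes N on top at location a
  infixl 30 _∙_＠_
  _∙_＠_ : ∀ {X} → Family X → X → Loc → Family X
  S ∙ N ＠ a = updateAt S a (N ∷_)

  Memory : ℕ → Set
  Memory v = Family (Term v)

  Continuation : ℕ → Set
  Continuation v = List (Term v)

  State : ℕ → Set
  State v = Memory v × Term v × Continuation v

  infix 4 _∣_⇓[_]_
  data _∣_⇓[_]_ {v : ℕ} : Memory v → Term v → ℕ → Memory v → Set where
    ⇓-unit : ∀ {S} → S ∣ ⋆ ⇓[ 1 ] S
    ⇓-seq  : ∀ {R S T M N m n} →
             R ∣ M ⇓[ m ] S → S ∣ N ⇓[ n ] T →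
             R ∣ M ⨾ N ⇓[ m + n + 1 ] T
    ⇓-app  : ∀ {S T M N a n} →
             S ∙ N ＠ a ∣ M ⇓[ n ] T →
             S ∣ app N a M ⇓[ n + 1 ] T
    ⇓-abs  : ∀ {S T M N a n} →
             S ∣ ⟪ N ⟫ M ⇓[ n ] T →
             S ∙ N ＠ a ∣ abs a M ⇓[ n + 1 ] T

  -- Collection types are multisets: they are represented by lists and
  -- identified by the relations _≈_, _≈ᶜ_, _≈ᴹ_ below.
  infix 20 _⇒_
  data CompType : Set

  CollType : Set
  CollType = List CompType

  MemType : Set
  MemType = Family CollType

  data CompType where
    _⇒_ : MemType → MemType → CompType

  -- Equality of types: reordering of collections, at every depth
  infix 4 _≈_ _≈ᶜ_ _≈ᴹ_ _≈ᴳ_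
  data _≈_ : CompType → CompType → Set

  _≈ᶜ_ : CollType → CollType → Set
  _≈ᶜ_ = Permutation _≈_

  _≈ᴹ_ : MemType → MemType → Set
  _≈ᴹ_ = Vec.Pointwise (List.Pointwise _≈ᶜ_)

  data _≈_ where
    _⇒_ : ∀ {I J K L} → I ≈ᴹ J → K ≈ᴹ L → I ⇒ K ≈ J ⇒ L

  -- Contexts assign a collection type to each variable in scope; variables
  -- outside the scope implicitly have type [].
  Context : ℕ → Set
  Context v = Vec CollType v

  _≈ᴳ_ : ∀ {v} → Context v → Context v → Set
  _≈ᴳ_ = Vec.Pointwise _≈ᶜ_

  ∅ : ∀ {v} → Context v
  ∅ = replicate _ []

  infixl 6 _⊞_
  _⊞_ : ∀ {v} → Context v → Context v → Context v
  _⊞_ = zipWith _++_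

  -- Weak typing.  The conv rules, here and in the judgements below, only
  -- express that types and contexts are taken up to multiset equality; they
  -- have no weight.  The n-ary collection rule is split into its nullary case
  -- and the addition of one more premise, both without weight.
  infix 4 _⊢_∶_ _⊢_∶ᶜ_
  data _⊢_∶_ {v : ℕ} : Context v → Term v → CompType → Set
  data _⊢_∶ᶜ_ {v : ℕ} : Context v → Term v → CollType → Set

  data _⊢_∶_ {v} where
    ty-var  : ∀ {x τ} → ∅ [ x ]≔ (τ ∷ []) ⊢ var x ∶ τ
    ty-abs  : ∀ {Γ a M ι K L} →
              ι ∷ Γ ⊢ M ∶ K ⇒ L →
              Γ ⊢ abs a M ∶ K ∙ ι ＠ a ⇒ L
    ty-app  : ∀ {Γ Δ N a M ι K L} →
              Γ ⊢ N ∶ᶜ ι → Δ ⊢ M ∶ K ∙ ι ＠ a ⇒ L →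
              Γ ⊞ Δ ⊢ app N a M ∶ K ⇒ L
    ty-unit : ∀ {I} → ∅ ⊢ ⋆ ∶ I ⇒ I
    ty-seq  : ∀ {Γ Δ N M I K L} →
              Γ ⊢ N ∶ I ⇒ K → Δ ⊢ M ∶ K ⇒ L →
              Γ ⊞ Δ ⊢ N ⨾ M ∶ I ⇒ L
    ty-conv : ∀ {Γ Δ M σ τ} → Γ ≈ᴳ Δ → σ ≈ τ → Γ ⊢ M ∶ σ → Δ ⊢ M ∶ τ

  data _⊢_∶ᶜ_ {v} where
    coll-nil  : ∀ {M} → ∅ ⊢ M ∶ᶜ []
    coll-cons : ∀ {Γ Δ M τ ι} →
                Γ ⊢ M ∶ τ → Δ ⊢ M ∶ᶜ ι → Γ ⊞ Δ ⊢ M ∶ᶜ τ ∷ ι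
    coll-conv : ∀ {Γ Δ M ι κ} → Γ ≈ᴳ Δ → ι ≈ᶜ κ → Γ ⊢ M ∶ᶜ ι → Δ ⊢ M ∶ᶜ κ

  infix 4 ⊢ᴹ_∶_ ⊢ᴷ_∶_ ⊢ˢ_∶_
  data ⊢ᴹ_∶_ {v : ℕ} : Memory v → MemType → Set where
    mem-ε    : ⊢ᴹ ε ∶ ε
    mem-push : ∀ {S I M κ a} →
               ⊢ᴹ S ∶ I → ∅ ⊢ M ∶ᶜ κ → ⊢ᴹ S ∙ M ＠ a ∶ I ∙ κ ＠ a
    mem-conv : ∀ {S I J} → I ≈ᴹ J → ⊢ᴹ S ∶ I → ⊢ᴹ S ∶ J

  data ⊢ᴷ_∶_ {v : ℕ} : Continuation v → CompType → Set where
    cont-ε    : ∀ {I} → ⊢ᴷ [] ∶ I ⇒ I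
    cont-cons : ∀ {M Ks I K L} →
                ∅ ⊢ M ∶ I ⇒ K → ⊢ᴷ Ks ∶ K ⇒ L → ⊢ᴷ M ∷ Ks ∶ I ⇒ L
    cont-conv : ∀ {Ks σ τ} → σ ≈ τ → ⊢ᴷ Ks ∶ σ → ⊢ᴷ Ks ∶ τ

  data ⊢ˢ_∶_ {v : ℕ} : State v → CompType → Set where
    state      : ∀ {S M Ks I K L} →
                 ⊢ᴹ S ∶ I → ∅ ⊢ M ∶ I ⇒ K → ⊢ᴷ Ks ∶ K ⇒ L →
                 ⊢ˢ (S , M , Ks) ∶ ε ⇒ L
    state-conv : ∀ {s σ τ} → σ ≈ τ → ⊢ˢ s ∶ σ → ⊢ˢ s ∶ τ

  weight  : ∀ {v} {Γ : Context v} {M τ} → Γ ⊢ M ∶ τ → ℕ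
  weightᶜ : ∀ {v} {Γ : Context v} {M ι} → Γ ⊢ M ∶ᶜ ι → ℕ

  weight ty-var          = 0
  weight (ty-abs d)      = weight d + 1
  weight (ty-app d e)    = weightᶜ d + weight e + 1
  weight ty-unit         = 1
  weight (ty-seq d e)    = weight d + weight e + 1
  weight (ty-conv _ _ d) = weight d

  weightᶜ coll-nil          = 0
  weightᶜ (coll-cons d e)   = weight d + weightᶜ e
  weightᶜ (coll-conv _ _ d) = weightᶜ d

  weightᴹ : ∀ {v} {S : Memory v} {I} → ⊢ᴹ S ∶ I → ℕ
  weightᴹ mem-ε          = 0
  weightᴹ (mem-push d e) = weightᴹ d + weightᶜ e
  weightᴹ (mem-conv _ d) = weightᴹ d

  weightᴷ : ∀ {v} {Ks : Continuation v} {τ} → ⊢ᴷ Ks ∶ τ → ℕ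
  weightᴷ cont-ε          = 0
  weightᴷ (cont-cons d e) = weight d + weightᴷ e
  weightᴷ (cont-conv _ d) = weightᴷ d

  weightˢ : ∀ {v} {s : State v} {τ} → ⊢ˢ s ∶ τ → ℕ
  weightˢ (state d e f)    = weightᴹ d + weight e + weightᴷ f
  weightˢ (state-conv _ d) = weightˢ d

  infix 4 ⊢ᴹ[_]_∶_ ⊢ˢ[_]_∶_
  ⊢ᴹ[_]_∶_ : ∀ {v} → ℕ → Memory v → MemType → Set
  ⊢ᴹ[ n ] S ∶ I = Σ[ d ∈ ⊢ᴹ S ∶ I ] weightᴹ d ≡ n

  ⊢ˢ[_]_∶_ : ∀ {v} → ℕ → State v → CompType → Set
  ⊢ˢ[ n ] s ∶ τ = Σ[ d ∈ ⊢ˢ s ∶ τ ] weightˢ d ≡ n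

{-# OPTIONS --safe #-}
module Submission where

-- Substituting N for x in M replaces each of the variable rules typing x in the
-- derivation of M, which weigh nothing, by one of the derivations collected for
-- N, each used exactly once.  Hence substitution adds weights, and every step of
-- the machine removes exactly one rule of positive weight from the derivation of
-- the state.  Evaluation therefore terminates by induction on the weight, and
-- what remains at the end is a derivation for the final memory.

open import Defs
open import Algebra.Bundles using (CommutativeMonoid)
import Algebra.Properties.CommutativeSemigroup as CommutativeSemigroupProperties
open import Data.Empty using (⊥-elim)
open import Data.Fin using (Fin; zero; suc)
open import Data.Fin.Properties using (_≟_)
open import Data.List using (List; []; _∷_; _++_)
open import Data.List.Properties using (∷-injective)
import Data.List.Relation.Binary.Permutation.Homogeneous as Perm
open import Data.List.Relation.Binary.Permutation.Homogeneous using (Permutation)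
import Data.List.Relation.Binary.Permutation.Setoid.Properties as PermProperties
import Data.List.Relation.Binary.Pointwise as List
open import Data.List.Relation.Binary.Pointwise using ([]; _∷_)
open import Data.Nat using (ℕ; zero; suc; _+_; _<_)
open import Data.Nat.Induction using (<-wellFounded)
open import Data.Nat.Properties using (m≤m+n; +-identityʳ; +-assoc)
open import Data.Nat.Tactic.RingSolver using (solve-∀)
open import Data.Product using (Σ-syntax; ∃-syntax; _×_; _,_)
open import Data.Vec using (Vec; []; _∷_; head; tail; lookup; replicate; zipWith; _[_]≔_)
open import Data.Vec.Properties using (lookup∘updateAt; lookup∘updateAt′; lookup-replicate; updateAt-updateAt; updateAt-commutes; []≔-lookup)
import Data.Vec.Relation.Binary.Pointwise.Inductive as Vec
open import Data.Vec.Relation.Binary.Pointwise.Inductive using ([]; _∷_)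
open import Function using (_∘_)
open import Induction.WellFounded using (Acc; acc)
open import Level using (_⊔_)
open import Relation.Binary.Bundles using (Setoid)
open import Relation.Binary.PropositionalEquality using (_≡_; _≢_; refl; sym; trans; cong; cong₂)
open import Relation.Nullary using (yes; no)

-- Pointwise commutative monoids of vectors.

module _ {c ℓ} (M : CommutativeMonoid c ℓ) where
  private module M = CommutativeMonoid M

  zipWith-commutativeMonoid : ℕ → CommutativeMonoid c (c ⊔ ℓ)
  zipWith-commutativeMonoid n = record
    { Carrier = Vec M.Carrier n
    ; _≈_     = Vec.Pointwise M._≈_
    ; _∙_     = zipWith M._∙_
    ; ε       = replicate n M.ε
    ; isCommutativeMonoid = record
      { isMonoid = record
        { isSemigroup = record
          { isMagma = record
            { isEquivalence = Vec.isEquivalence M.isEquivalence n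
            ; ∙-cong        = zip-cong
            }
          ; assoc = zip-assoc
          }
        ; identity = zip-identityˡ , zip-identityʳ
        }
      ; comm = zip-comm
      }
    }
    where
    zip-cong : ∀ {n} {xs ys us vs : Vec M.Carrier n} →
               Vec.Pointwise M._≈_ xs ys → Vec.Pointwise M._≈_ us vs →
               Vec.Pointwise M._≈_ (zipWith M._∙_ xs us) (zipWith M._∙_ ys vs)
    zip-cong []       []       = []
    zip-cong (p ∷ ps) (q ∷ qs) = M.∙-cong p q ∷ zip-cong ps qs

    zip-assoc : ∀ {n} (xs ys zs : Vec M.Carrier n) →
                Vec.Pointwise M._≈_ (zipWith M._∙_ (zipWith M._∙_ xs ys) zs)
                                    (zipWith M._∙_ xs (zipWith M._∙_ ys zs))
    zip-assoc []       []       []       = []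
    zip-assoc (x ∷ xs) (y ∷ ys) (z ∷ zs) = M.assoc x y z ∷ zip-assoc xs ys zs

    zip-comm : ∀ {n} (xs ys : Vec M.Carrier n) →
               Vec.Pointwise M._≈_ (zipWith M._∙_ xs ys) (zipWith M._∙_ ys xs)
    zip-comm []       []       = []
    zip-comm (x ∷ xs) (y ∷ ys) = M.comm x y ∷ zip-comm xs ys

    zip-identityˡ : ∀ {n} (xs : Vec M.Carrier n) →
                    Vec.Pointwise M._≈_ (zipWith M._∙_ (replicate n M.ε) xs) xs
    zip-identityˡ []       = []
    zip-identityˡ (x ∷ xs) = M.identityˡ x ∷ zip-identityˡ xs

    zip-identityʳ : ∀ {n} (xs : Vec M.Carrier n) →
                    Vec.Pointwise M._≈_ (zipWith M._∙_ xs (replicate n M.ε)) xs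
    zip-identityʳ []       = []
    zip-identityʳ (x ∷ xs) = M.identityʳ x ∷ zip-identityʳ xs

Pointwise-[]≔ : ∀ {a r} {A : Set a} {R : A → A → Set r} {n} {xs ys : Vec A n} {x y} i →
                Vec.Pointwise R xs ys → R x y → Vec.Pointwise R (xs [ i ]≔ x) (ys [ i ]≔ y)
Pointwise-[]≔ zero    (_ ∷ ps) p = p ∷ ps
Pointwise-[]≔ (suc i) (q ∷ ps) p = q ∷ Pointwise-[]≔ i ps p

-- The generators `prep` and `swap` relate only nonempty lists, so just `refl` and `trans` remain.
↭-[]⇒≡[] : ∀ {a r} {A : Set a} {R : A → A → Set r} {xs ys : List A} →
            Permutation R xs ys → ys ≡ [] → xs ≡ []
↭-[]⇒≡[] (Perm.refl [])    refl = refl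
↭-[]⇒≡[] (Perm.trans p q)  eq   = ↭-[]⇒≡[] p (↭-[]⇒≡[] q eq)

module _ (k : ℕ) where
  open Machine k

  -- Equality of types is an equivalence.

  ≈-refl     : ∀ {τ} → τ ≈ τ
  ≈ᴹ-refl    : ∀ {n} {I : Vec (List CollType) n} → Vec.Pointwise (List.Pointwise _≈ᶜ_) I I
  stack-refl : ∀ {ιs} → List.Pointwise _≈ᶜ_ ιs ιs
  coll-refl  : ∀ {ι} → List.Pointwise _≈_ ι ι

  ≈-refl {I ⇒ K} = ≈ᴹ-refl ⇒ ≈ᴹ-refl
  ≈ᴹ-refl {I = []}     = []
  ≈ᴹ-refl {I = ιs ∷ I} = stack-refl ∷ ≈ᴹ-refl
  stack-refl {[]}     = []
  stack-refl {ι ∷ ιs} = Perm.refl coll-refl ∷ stack-refl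
  coll-refl {[]}     = []
  coll-refl {τ ∷ ι} = ≈-refl ∷ coll-refl

  ≈-sym     : ∀ {σ τ} → σ ≈ τ → τ ≈ σ
  ≈ᴹ-sym    : ∀ {n} {I J : Vec (List CollType) n} →
              Vec.Pointwise (List.Pointwise _≈ᶜ_) I J → Vec.Pointwise (List.Pointwise _≈ᶜ_) J I
  stack-sym : ∀ {ιs κs} → List.Pointwise _≈ᶜ_ ιs κs → List.Pointwise _≈ᶜ_ κs ιs
  ≈ᶜ-sym    : ∀ {ι κ} → ι ≈ᶜ κ → κ ≈ᶜ ι
  coll-sym  : ∀ {ι κ} → List.Pointwise _≈_ ι κ → List.Pointwise _≈_ κ ι

  ≈-sym (p ⇒ q) = ≈ᴹ-sym p ⇒ ≈ᴹ-sym q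
  ≈ᴹ-sym []       = []
  ≈ᴹ-sym (p ∷ ps) = stack-sym p ∷ ≈ᴹ-sym ps
  stack-sym []       = []
  stack-sym (p ∷ ps) = ≈ᶜ-sym p ∷ stack-sym ps
  ≈ᶜ-sym (Perm.refl ps)    = Perm.refl (coll-sym ps)
  ≈ᶜ-sym (Perm.prep p q)   = Perm.prep (≈-sym p) (≈ᶜ-sym q)
  ≈ᶜ-sym (Perm.swap p q r) = Perm.swap (≈-sym q) (≈-sym p) (≈ᶜ-sym r)
  ≈ᶜ-sym (Perm.trans p q)  = Perm.trans (≈ᶜ-sym q) (≈ᶜ-sym p)
  coll-sym []       = []
  coll-sym (p ∷ ps) = ≈-sym p ∷ coll-sym ps

  ≈ᴹ-trans : ∀ {I J K : MemType} → I ≈ᴹ J → J ≈ᴹ K → I ≈ᴹ K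
  ≈ᴹ-trans = Vec.trans (List.transitive Perm.trans)

  ≈-trans : ∀ {ρ σ τ} → ρ ≈ σ → σ ≈ τ → ρ ≈ τ
  ≈-trans (p ⇒ q) (r ⇒ s) = ≈ᴹ-trans p r ⇒ ≈ᴹ-trans q s

  ≈ᴹ-reflexive : ∀ {I J : MemType} → I ≡ J → I ≈ᴹ J
  ≈ᴹ-reflexive refl = ≈ᴹ-refl

  ≈-setoid : Setoid _ _
  ≈-setoid = record
    { _≈_ = _≈_
    ; isEquivalence = record { refl = ≈-refl ; sym = ≈-sym ; trans = ≈-trans }
    }

  -- The monoid of contexts and its empty elements.

  ⊞-commutativeMonoid : ℕ → CommutativeMonoid _ _
  ⊞-commutativeMonoid = zipWith-commutativeMonoid (PermProperties.++-commutativeMonoid ≈-setoid)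

  module ⊞ {v : ℕ} where
    open CommutativeMonoid (⊞-commutativeMonoid v) public
      using (∙-cong; assoc; identityˡ; identityʳ)
      renaming (refl to ≈ᴳ-refl; sym to ≈ᴳ-sym; trans to ≈ᴳ-trans)
    open CommutativeSemigroupProperties
      (CommutativeMonoid.commutativeSemigroup (⊞-commutativeMonoid v)) public
      using (interchange; x∙yz≈y∙xz)
  open ⊞ using (≈ᴳ-refl; ≈ᴳ-sym; ≈ᴳ-trans)

  ≈ᴳ-∅⇒≡∅ : ∀ {v} {Γ : Context v} → Γ ≈ᴳ ∅ → Γ ≡ ∅
  ≈ᴳ-∅⇒≡∅ {Γ = []}    []       = refl
  ≈ᴳ-∅⇒≡∅ {Γ = _ ∷ _} (p ∷ ps) = cong₂ _∷_ (↭-[]⇒≡[] p refl) (≈ᴳ-∅⇒≡∅ ps)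

  -- Collections have no inverses under concatenation. Hence the premises of a rule with empty
  -- context have empty contexts too, which keeps evaluation among closed typings.
  ⊞≡∅⇒≡∅ : ∀ {v} (Γ Δ : Context v) → Γ ⊞ Δ ≡ ∅ → Γ ≡ ∅ × Δ ≡ ∅
  ⊞≡∅⇒≡∅ []       []       _  = refl , refl
  ⊞≡∅⇒≡∅ ([] ∷ Γ) ([] ∷ Δ) eq with ⊞≡∅⇒≡∅ Γ Δ (cong tail eq)
  ... | refl , refl = refl , refl

  singleton≢∅ : ∀ {v} (x : Fin v) {τ} → ∅ [ x ]≔ (τ ∷ []) ≢ ∅
  singleton≢∅ zero    ()
  singleton≢∅ (suc x) eq = singleton≢∅ x (cong tail eq)

  -- Weighted typing and its invariance under renaming.

  infix 4 _⊢[_]_∶_ _⊢[_]_∶ᶜ_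
  _⊢[_]_∶_ : ∀ {v} → Context v → ℕ → Term v → CompType → Set
  Γ ⊢[ n ] M ∶ τ = Σ[ d ∈ Γ ⊢ M ∶ τ ] weight d ≡ n

  _⊢[_]_∶ᶜ_ : ∀ {v} → Context v → ℕ → Term v → CollType → Set
  Γ ⊢[ n ] M ∶ᶜ ι = Σ[ d ∈ Γ ⊢ M ∶ᶜ ι ] weightᶜ d ≡ n

  -- `f` is the action on contexts that accompanies `ρ`. The fields are what the induction on
  -- derivations asks of it: one each for conversion, for empty contexts, for sums and for
  -- variables.
  record Transports {v w} (ρ : Ren v w) (f : Context v → Context w) : Set where
    field
      ≈ᴳ-cong : ∀ {Γ Δ} → Γ ≈ᴳ Δ → f Γ ≈ᴳ f Δ
      ∅-homo  : ∅ ≈ᴳ f ∅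
      ⊞-homo  : ∀ Γ Δ → f Γ ⊞ f Δ ≈ᴳ f (Γ ⊞ Δ)
      var-homo : ∀ x τ → ∅ [ ρ x ]≔ (τ ∷ []) ≈ᴳ f (∅ [ x ]≔ (τ ∷ []))

  weaken-transports : ∀ {v} → Transports {v} suc ([] ∷_)
  weaken-transports = record
    { ≈ᴳ-cong  = Perm.refl [] ∷_
    ; ∅-homo   = ≈ᴳ-refl
    ; ⊞-homo   = λ _ _ → ≈ᴳ-refl
    ; var-homo = λ _ _ → ≈ᴳ-refl
    }

  lift-transports : ∀ {v w} {ρ : Ren v w} {f} → Transports ρ f →
                    Transports (liftRen ρ) (λ Γ → head Γ ∷ f (tail Γ))
  lift-transports {ρ = ρ} {f} t = record
    { ≈ᴳ-cong  = λ { (p ∷ ps) → p ∷ ≈ᴳ-cong ps }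
    ; ∅-homo   = Perm.refl [] ∷ ∅-homo
    ; ⊞-homo   = λ { (_ ∷ Γ) (_ ∷ Δ) → Perm.refl coll-refl ∷ ⊞-homo Γ Δ }
    ; var-homo = λ { zero τ → Perm.refl coll-refl ∷ ∅-homo ; (suc x) τ → Perm.refl [] ∷ var-homo x τ }
    }
    where open Transports t

  ⊢-rename : ∀ {v w} {ρ : Ren v w} {f Γ M τ} → Transports ρ f →
             (d : Γ ⊢ M ∶ τ) → f Γ ⊢[ weight d ] rename ρ M ∶ τ
  ⊢ᶜ-rename : ∀ {v w} {ρ : Ren v w} {f Γ M ι} → Transports ρ f →
              (d : Γ ⊢ M ∶ᶜ ι) → f Γ ⊢[ weightᶜ d ] rename ρ M ∶ᶜ ι

  ⊢-rename t ty-var = ty-conv (Transports.var-homo t _ _) ≈-refl ty-var , refl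
  ⊢-rename t (ty-abs d) with ⊢-rename (lift-transports t) d
  ... | d′ , eq = ty-abs d′ , cong (_+ 1) eq
  ⊢-rename t (ty-app d e) with ⊢ᶜ-rename t d | ⊢-rename t e
  ... | d′ , p | e′ , q =
    ty-conv (Transports.⊞-homo t _ _) ≈-refl (ty-app d′ e′) , cong (_+ 1) (cong₂ _+_ p q)
  ⊢-rename t ty-unit = ty-conv (Transports.∅-homo t) ≈-refl ty-unit , refl
  ⊢-rename t (ty-seq d e) with ⊢-rename t d | ⊢-rename t e
  ... | d′ , p | e′ , q =
    ty-conv (Transports.⊞-homo t _ _) ≈-refl (ty-seq d′ e′) , cong (_+ 1) (cong₂ _+_ p q)
  ⊢-rename t (ty-conv p q d) with ⊢-rename t d
  ... | d′ , eq = ty-conv (Transports.≈ᴳ-cong t p) q d′ , eq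

  ⊢ᶜ-rename t coll-nil = coll-conv (Transports.∅-homo t) (Perm.refl []) coll-nil , refl
  ⊢ᶜ-rename t (coll-cons d e) with ⊢-rename t d | ⊢ᶜ-rename t e
  ... | d′ , p | e′ , q =
    coll-conv (Transports.⊞-homo t _ _) (Perm.refl coll-refl) (coll-cons d′ e′) , cong₂ _+_ p q
  ⊢ᶜ-rename t (coll-conv p q d) with ⊢ᶜ-rename t d
  ... | d′ , eq = coll-conv (Transports.≈ᴳ-cong t p) q d′ , eq

  -- Collections as bags of derivations.

  -- Collection typing with the uses of conversion confined to the contexts, so
  -- that a derivation has one component for each type in the collection.
  data Bag {v} (M : Term v) : Context v → CollType → ℕ → Set where
    nil  : ∀ {Γ} → ∅ ≈ᴳ Γ → Bag M Γ [] 0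
    cons : ∀ {Γ Δ Θ τ ι m n p} → Γ ⊢[ m ] M ∶ τ → Bag M Δ ι n →
           Γ ⊞ Δ ≈ᴳ Θ → m + n ≡ p → Bag M Θ (τ ∷ ι) p

  Bag-respᴳ : ∀ {v} {M : Term v} {Γ Δ ι n} → Γ ≈ᴳ Δ → Bag M Γ ι n → Bag M Δ ι n
  Bag-respᴳ p (nil q)         = nil (≈ᴳ-trans q p)
  Bag-respᴳ p (cons d b q eq) = cons d b (≈ᴳ-trans q p) eq

  ⊢[]-conv : ∀ {v} {M : Term v} {Γ Δ σ τ n} →
             Γ ≈ᴳ Δ → σ ≈ τ → Γ ⊢[ n ] M ∶ σ → Δ ⊢[ n ] M ∶ τ
  ⊢[]-conv p q (d , eq) = ty-conv p q d , eq

  +-swapˡ : ∀ a b c → a + (b + c) ≡ b + (a + c)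
  +-swapˡ = solve-∀

  -- Equalities of single types become conversions of single components, and a transposition
  -- exchanges two neighbouring components, which commutativity of context sums and of addition
  -- absorbs.
  Bag-respᶜ : ∀ {v} {M : Term v} {Γ ι κ n} → ι ≈ᶜ κ → Bag M Γ ι n → Bag M Γ κ n
  Bag-respᶜ (Perm.refl [])       b = b
  Bag-respᶜ (Perm.refl (p ∷ ps)) (cons d b q eq) =
    cons (⊢[]-conv ≈ᴳ-refl p d) (Bag-respᶜ (Perm.refl ps) b) q eq
  Bag-respᶜ (Perm.prep p ps)     (cons d b q eq) =
    cons (⊢[]-conv ≈ᴳ-refl p d) (Bag-respᶜ ps b) q eq
  Bag-respᶜ (Perm.swap p q ps)   (cons {m = l} d (cons {m = m} {n = n} e b r refl) s refl) =
    cons (⊢[]-conv ≈ᴳ-refl q e)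
      (cons (⊢[]-conv ≈ᴳ-refl p d) (Bag-respᶜ ps b) ≈ᴳ-refl refl)
      (≈ᴳ-trans (⊞.x∙yz≈y∙xz _ _ _) (≈ᴳ-trans (⊞.∙-cong ≈ᴳ-refl r) s))
      (+-swapˡ m l n)
  Bag-respᶜ (Perm.trans p q)     b = Bag-respᶜ q (Bag-respᶜ p b)

  ⊢ᶜ⇒Bag : ∀ {v} {M : Term v} {Γ ι} (d : Γ ⊢ M ∶ᶜ ι) → Bag M Γ ι (weightᶜ d)
  ⊢ᶜ⇒Bag coll-nil          = nil ≈ᴳ-refl
  ⊢ᶜ⇒Bag (coll-cons d e)   = cons (d , refl) (⊢ᶜ⇒Bag e) ≈ᴳ-refl refl
  ⊢ᶜ⇒Bag (coll-conv p q d) = Bag-respᴳ p (Bag-respᶜ q (⊢ᶜ⇒Bag d))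

  -- Each component goes to exactly one side, with nothing copied or dropped, so contexts and
  -- weights are divided exactly.
  Bag-split : ∀ {v} {M : Term v} {Γ} ι {κ n} → Bag M Γ (ι ++ κ) n →
              ∃[ Γ₁ ] ∃[ Γ₂ ] ∃[ n₁ ] ∃[ n₂ ]
              Bag M Γ₁ ι n₁ × Bag M Γ₂ κ n₂ × Γ₁ ⊞ Γ₂ ≈ᴳ Γ × n₁ + n₂ ≡ n
  Bag-split []      b = _ , _ , _ , _ , nil ≈ᴳ-refl , b , ⊞.identityˡ _ , refl
  Bag-split (τ ∷ ι) (cons {m = m} d b p refl) with Bag-split ι b
  ... | _ , _ , n₁ , n₂ , b₁ , b₂ , q , refl =
    _ , _ , _ , _ , cons d b₁ ≈ᴳ-refl refl , b₂ ,
    ≈ᴳ-trans (⊞.assoc _ _ _) (≈ᴳ-trans (⊞.∙-cong ≈ᴳ-refl q) p) , +-assoc m n₁ n₂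

  Bag-weaken : ∀ {v} {M : Term v} {Γ ι n} → Bag M Γ ι n → Bag (rename suc M) ([] ∷ Γ) ι n
  Bag-weaken (nil p) = nil (Perm.refl [] ∷ p)
  Bag-weaken (cons (d , refl) b p eq) =
    cons (⊢-rename weaken-transports d) (Bag-weaken b) (Perm.refl [] ∷ p) eq

  -- One variable rule per type in `ι`, all weightless: a substitution can therefore be carried
  -- under a binder at no cost.
  Bag-var : ∀ {v} ι → Bag {suc v} (var zero) (ι ∷ ∅) ι 0
  Bag-var []      = nil ≈ᴳ-refl
  Bag-var (τ ∷ ι) = cons (ty-var , refl) (Bag-var ι) (Perm.refl coll-refl ∷ ⊞.identityˡ _) refl

  -- Typed simultaneous substitutions.

  -- SubTy σ Γ Δ n: the term σ x has a typing of collection type Γ(x) for each x,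
  -- and Δ and n are the sums of the contexts and of the weights of these typings.
  data SubTy {w} : ∀ {v} → Sub v w → Context v → Context w → ℕ → Set where
    nil  : ∀ {σ Δ} → ∅ ≈ᴳ Δ → SubTy {v = zero} σ [] Δ 0
    cons : ∀ {v} {σ : Sub (suc v) w} {ι Γ Δ₀ Δ Θ m n p} →
           Bag (σ zero) Δ₀ ι m → SubTy (σ ∘ suc) Γ Δ n →
           Δ₀ ⊞ Δ ≈ᴳ Θ → m + n ≡ p → SubTy σ (ι ∷ Γ) Θ p

  SubTy-resp : ∀ {v w} {σ : Sub v w} {Γ Γ′ Δ n} → Γ ≈ᴳ Γ′ → SubTy σ Γ Δ n → SubTy σ Γ′ Δ n
  SubTy-resp []       (nil q)         = nil q
  SubTy-resp (p ∷ ps) (cons b s q eq) = cons (Bag-respᶜ p b) (SubTy-resp ps s) q eq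

  SubTy-∅ : ∀ {v w} (σ : Sub v w) → SubTy σ ∅ ∅ 0
  SubTy-∅ {zero}  σ = nil ≈ᴳ-refl
  SubTy-∅ {suc v} σ = cons (nil ≈ᴳ-refl) (SubTy-∅ (σ ∘ suc)) (⊞.identityˡ _) refl

  SubTy-∅⁻¹ : ∀ {v w} {σ : Sub v w} {Δ n} → SubTy σ ∅ Δ n → ∅ ≈ᴳ Δ × n ≡ 0
  SubTy-∅⁻¹ {zero}  (nil p) = p , refl
  SubTy-∅⁻¹ {suc v} (cons (nil p) s q refl) with SubTy-∅⁻¹ s
  ... | r , refl = ≈ᴳ-trans (≈ᴳ-sym (⊞.identityˡ _)) (≈ᴳ-trans (⊞.∙-cong p r) q) , refl

  +-interchange : ∀ a b c d → (a + c) + (b + d) ≡ (a + b) + (c + d)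
  +-interchange = solve-∀

  SubTy-split : ∀ {v w} {σ : Sub v w} Γ₁ Γ₂ {Δ n} → SubTy σ (Γ₁ ⊞ Γ₂) Δ n →
                ∃[ Δ₁ ] ∃[ Δ₂ ] ∃[ n₁ ] ∃[ n₂ ]
                SubTy σ Γ₁ Δ₁ n₁ × SubTy σ Γ₂ Δ₂ n₂ × Δ₁ ⊞ Δ₂ ≈ᴳ Δ × n₁ + n₂ ≡ n
  SubTy-split [] [] s = _ , _ , _ , _ , nil ≈ᴳ-refl , s , ⊞.identityˡ _ , refl
  SubTy-split (ι ∷ Γ₁) (κ ∷ Γ₂) (cons b s p refl) with Bag-split ι b | SubTy-split Γ₁ Γ₂ s
  ... | _ , _ , m₁ , m₂ , b₁ , b₂ , q , refl | _ , _ , n₁ , n₂ , s₁ , s₂ , r , refl =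
    _ , _ , _ , _ , cons b₁ s₁ ≈ᴳ-refl refl , cons b₂ s₂ ≈ᴳ-refl refl ,
    ≈ᴳ-trans (⊞.interchange _ _ _ _) (≈ᴳ-trans (⊞.∙-cong q r) p) ,
    +-interchange m₁ m₂ n₁ n₂

  -- The bag at `x` has a single component and all others are empty, so that component accounts for
  -- all of `Δ` and `n`.
  SubTy-lookup : ∀ {v w} {σ : Sub v w} x {τ Δ n} →
                 SubTy σ (∅ [ x ]≔ (τ ∷ [])) Δ n → Δ ⊢[ n ] σ x ∶ τ
  SubTy-lookup zero (cons (cons {m = m} (d , refl) (nil p) q refl) s r refl) with SubTy-∅⁻¹ s
  ... | p′ , refl =
    ty-conv (≈ᴳ-trans (≈ᴳ-sym (⊞.identityʳ _))
              (≈ᴳ-trans (⊞.∙-cong (≈ᴳ-trans (≈ᴳ-sym (⊞.identityʳ _)) (≈ᴳ-trans (⊞.∙-cong ≈ᴳ-refl p) q)) p′) r))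
            ≈-refl d ,
    sym (trans (+-identityʳ (m + 0)) (+-identityʳ m))
  SubTy-lookup (suc x) (cons (nil p) s q refl) with SubTy-lookup x s
  ... | d = ⊢[]-conv (≈ᴳ-trans (≈ᴳ-sym (⊞.identityˡ _)) (≈ᴳ-trans (⊞.∙-cong p ≈ᴳ-refl) q)) ≈-refl d

  SubTy-weaken : ∀ {v w} {σ : Sub v w} {Γ Δ n} →
                 SubTy σ Γ Δ n → SubTy (rename suc ∘ σ) Γ ([] ∷ Δ) n
  SubTy-weaken (nil p)         = nil (Perm.refl [] ∷ p)
  SubTy-weaken (cons b s p eq) = cons (Bag-weaken b) (SubTy-weaken s) (Perm.refl [] ∷ p) eq

  SubTy-lift : ∀ {v w} {σ : Sub v w} {Γ Δ n} ι →
               SubTy σ Γ Δ n → SubTy (liftSub σ) (ι ∷ Γ) (ι ∷ Δ) n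
  SubTy-lift ι s =
    cons (Bag-var ι) (SubTy-weaken s)
      (PermProperties.++-identityʳ ≈-setoid ι ∷ ⊞.identityˡ _) refl

  -- Substitution adds weights.

  +-interchange₁ : ∀ a b c d → (a + c) + (b + d) + 1 ≡ (a + b + 1) + (c + d)
  +-interchange₁ = solve-∀

  +-swapʳ₁ : ∀ a b → a + b + 1 ≡ a + 1 + b
  +-swapʳ₁ = solve-∀

  -- Stated for simultaneous substitutions so that the induction passes under binders by
  -- `SubTy-lift`. Rules with two premises divide the substitution by `SubTy-split`; a variable
  -- rule, of weight 0, is replaced by the derivation it requests.
  ⊢-subst : ∀ {v w} {σ : Sub v w} {Γ Δ M τ n} (d : Γ ⊢ M ∶ τ) →
            SubTy σ Γ Δ n → Δ ⊢[ weight d + n ] subst σ M ∶ τ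
  ⊢ᶜ-subst : ∀ {v w} {σ : Sub v w} {Γ Δ M ι n} (d : Γ ⊢ M ∶ᶜ ι) →
             SubTy σ Γ Δ n → Δ ⊢[ weightᶜ d + n ] subst σ M ∶ᶜ ι

  ⊢-subst ty-var s = SubTy-lookup _ s
  ⊢-subst {n = n} (ty-abs d) s with ⊢-subst d (SubTy-lift _ s)
  ... | d′ , eq = ty-abs d′ , trans (cong (_+ 1) eq) (+-swapʳ₁ (weight d) n)
  ⊢-subst (ty-app {Γ} {Δ} d e) s with SubTy-split Γ Δ s
  ... | _ , _ , n₁ , n₂ , s₁ , s₂ , r , refl with ⊢ᶜ-subst d s₁ | ⊢-subst e s₂
  ... | d′ , p | e′ , q =
    ty-conv r ≈-refl (ty-app d′ e′) ,
    trans (cong (_+ 1) (cong₂ _+_ p q)) (+-interchange₁ (weightᶜ d) (weight e) n₁ n₂)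
  ⊢-subst ty-unit s with SubTy-∅⁻¹ s
  ... | p , refl = ty-conv p ≈-refl ty-unit , refl
  ⊢-subst (ty-seq {Γ} {Δ} d e) s with SubTy-split Γ Δ s
  ... | _ , _ , n₁ , n₂ , s₁ , s₂ , r , refl with ⊢-subst d s₁ | ⊢-subst e s₂
  ... | d′ , p | e′ , q =
    ty-conv r ≈-refl (ty-seq d′ e′) ,
    trans (cong (_+ 1) (cong₂ _+_ p q)) (+-interchange₁ (weight d) (weight e) n₁ n₂)
  ⊢-subst (ty-conv p q d) s = ⊢[]-conv ≈ᴳ-refl q (⊢-subst d (SubTy-resp (≈ᴳ-sym p) s))

  ⊢ᶜ-subst coll-nil s with SubTy-∅⁻¹ s
  ... | p , refl = coll-conv p (Perm.refl []) coll-nil , refl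
  ⊢ᶜ-subst (coll-cons {Γ} {Δ} d e) s with SubTy-split Γ Δ s
  ... | _ , _ , n₁ , n₂ , s₁ , s₂ , r , refl with ⊢-subst d s₁ | ⊢ᶜ-subst e s₂
  ... | d′ , p | e′ , q =
    coll-conv r (Perm.refl coll-refl) (coll-cons d′ e′) ,
    trans (cong₂ _+_ p q) (+-interchange (weight d) (weightᶜ e) n₁ n₂)
  ⊢ᶜ-subst (coll-conv p q d) s with ⊢ᶜ-subst d (SubTy-resp (≈ᴳ-sym p) s)
  ... | d′ , eq = coll-conv ≈ᴳ-refl q d′ , eq

  ⊢-single : ∀ {v} {N : Term v} {M ι τ} (d : ι ∷ ∅ ⊢ M ∶ τ) (e : ∅ ⊢ N ∶ᶜ ι) →
             ∅ ⊢[ weight d + weightᶜ e ] ⟪ N ⟫ M ∶ τ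
  ⊢-single d e =
    -- Past index zero `single N` acts as `var`, and the context there is empty, so only the bag for
    -- `N` contributes.
    ⊢-subst d (cons (⊢ᶜ⇒Bag e) (SubTy-∅ var) (⊞.identityˡ _) (+-identityʳ _))

  -- Popping from a typed memory.

  +-swapʳ : ∀ a b c → a + b + c ≡ a + c + b
  +-swapʳ = solve-∀

  -- The rules may push onto the locations in any interleaving, and a push at
  -- another location commutes with the push at a.
  mem-pop : ∀ {v} {S : Memory v} {J} a {ι ιs} (d : ⊢ᴹ S ∶ J) → lookup J a ≡ ι ∷ ιs →
            Σ[ S′ ∈ Memory v ] Σ[ N ∈ Term v ] S ≡ S′ ∙ N ＠ a ×
            Σ[ d′ ∈ ⊢ᴹ S′ ∶ J [ a ]≔ ιs ] Σ[ e ∈ ∅ ⊢ N ∶ᶜ ι ] weightᴹ d′ + weightᶜ e ≡ weightᴹ d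
  mem-pop a mem-ε eq with trans (sym (lookup-replicate a [])) eq
  ... | ()
  mem-pop a (mem-push {S} {I} {M} {κ} {b} d e) eq with a ≟ b
  ... | yes refl with ∷-injective (trans (sym (lookup∘updateAt a I)) eq)
  ...   | refl , refl =
    S , M , refl ,
    mem-conv (≈ᴹ-reflexive (sym (trans (updateAt-updateAt a I) ([]≔-lookup I a)))) d , e , refl
  mem-pop a (mem-push {S} {I} {M} {κ} {b} d e) eq | no a≢b
    with mem-pop a d (trans (sym (lookup∘updateAt′ a b a≢b I)) eq)
  ... | S′ , N , refl , d′ , e′ , weq =
    S′ ∙ M ＠ b , N , updateAt-commutes b a (a≢b ∘ sym) S′ ,
    mem-conv (≈ᴹ-reflexive (updateAt-commutes b a (a≢b ∘ sym) I)) (mem-push d′ e) , e′ ,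
    trans (+-swapʳ (weightᴹ d′) (weightᶜ e) (weightᶜ e′)) (cong (_+ weightᶜ e) weq)
  mem-pop a {ι} {ιs} (mem-conv {I = I} p d) eq with lookup I a in eq′ | Vec.lookup p a
  ... | ls | q rewrite eq with q
  -- Equality of vector types keeps the order of the stack: `r` relates the collections on top and
  -- converts the typing of the popped term, while `rs` converts the rest.
  ...   | r ∷ rs with mem-pop a d eq′
  ...     | S′ , N , S≡ , d′ , e , weq =
    S′ , N , S≡ , mem-conv (Pointwise-[]≔ a p rs) d′ , coll-conv ≈ᴳ-refl r e , weq

  -- Evaluation by induction on weight.

  Terminates : ∀ {v} → Memory v → Term v → MemType → ℕ → Set
  Terminates {v} S M K n =
    Σ[ T ∈ Memory v ] Σ[ m ∈ ℕ ] Σ[ j ∈ ℕ ] ((⊢ᴹ[ m ] T ∶ K) × (S ∣ M ⇓[ j ] T) × (n ≡ m + j))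

  -- Common form of the weight equations below: `a` is the weight passed to a recursive call, `suc`
  -- the rule just consumed, and `b` whatever is set aside, namely the other half of a sequence or
  -- 0.
  ≡suc+⇒< : ∀ {n} a b → n ≡ suc a + b → a < n
  ≡suc+⇒< a b refl = m≤m+n (suc a) b

  split-seq : ∀ p a b → p + (a + b + 1) ≡ suc (p + a) + b
  split-seq = solve-∀

  split-app : ∀ p a b → p + (a + b + 1) ≡ suc (p + a + b) + 0
  split-app = solve-∀

  split-abs : ∀ p e w → p + e + (w + 1) ≡ suc (p + (w + e)) + 0
  split-abs = solve-∀

  step-app : ∀ m j → suc (m + j) + 0 ≡ m + (j + 1)
  step-app = solve-∀

  step-seq₁ : ∀ m j b → suc (m + j) + b ≡ suc (m + b) + j
  step-seq₁ = solve-∀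

  step-seq₂ : ∀ m i j → suc (m + i) + j ≡ m + (j + i + 1)
  step-seq₂ = solve-∀

  -- The induction is lexicographic, on the weight and then on the derivation: conversion keeps the
  -- weight but shortens the derivation, while other recursive calls lower the weight. The context
  -- is a variable equated to `∅` because the rules conclude with sums and converted contexts.
  terminates : ∀ {n v} {S : Memory v} {I Γ M K} (dS : ⊢ᴹ S ∶ I) (d : Γ ⊢ M ∶ I ⇒ K) → Γ ≡ ∅ →
               n ≡ weightᴹ dS + weight d → Acc _<_ n → Terminates S M K n
  -- Free variables may occur in the term, but the empty context gives them no type, so evaluation
  -- never gets stuck on one.
  terminates dS (ty-var {x}) Γ≡∅ _ _ = ⊥-elim (singleton≢∅ x Γ≡∅)
  terminates dS (ty-conv p (q ⇒ r) d) refl eq ac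
    with terminates (mem-conv (≈ᴹ-sym q) dS) d (≈ᴳ-∅⇒≡∅ p) eq ac
  ... | T , m , j , (dT , weq) , run , eq′ = T , m , j , (mem-conv r dT , weq) , run , eq′
  terminates dS ty-unit _ eq _ = _ , _ , _ , (dS , refl) , ⇓-unit , eq
  terminates dS (ty-seq {Γ} {Δ} d e) Γ≡∅ eq (acc rec) with ⊞≡∅⇒≡∅ Γ Δ Γ≡∅
  ... | refl , refl
    with trans eq (split-seq (weightᴹ dS) (weight d) (weight e))
  ... | eq₁ with terminates dS d refl refl (rec (≡suc+⇒< _ (weight e) eq₁))
  ... | R , _ , j , (dR , refl) , run₁ , eq′
    -- The first run has turned its share of the weight into the memory `R` and `j` steps. Setting
    -- `j` aside leaves `R` and the second term with a weight below `n`.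
    with trans eq₁ (trans (cong (λ n → suc n + weight e) eq′) (step-seq₁ (weightᴹ dR) j (weight e)))
  ... | eq₂ with terminates dR e refl refl (rec (≡suc+⇒< _ j eq₂))
  ... | T , m , i , dT , run₂ , eq″ =
    T , m , _ , dT , ⇓-seq run₁ run₂ ,
    trans eq₂ (trans (cong (λ n → suc n + j) eq″) (step-seq₂ m i j))
  terminates dS (ty-app {Γ} {Δ} d e) Γ≡∅ eq (acc rec) with ⊞≡∅⇒≡∅ Γ Δ Γ≡∅
  ... | refl , refl
    with trans eq (split-app (weightᴹ dS) (weightᶜ d) (weight e))
  ... | eq₁ with terminates (mem-push dS d) e refl refl (rec (≡suc+⇒< _ 0 eq₁))
  ... | T , m , j , dT , run , eq′ =
    T , m , _ , dT , ⇓-app run , trans eq₁ (trans (cong (λ n → suc n + 0) eq′) (step-app m j))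
  -- The input type has `ι` on top at `a`, so the stack there is nonempty and the pop succeeds.
  terminates dS (ty-abs {a = a} {K = K} d) refl eq (acc rec) with mem-pop a dS (lookup∘updateAt a K)
  ... | S , N , refl , dS′ , e , weq with ⊢-single d e
  ... | d′ , weq′
    with trans eq (trans (cong (_+ (weight d + 1)) (sym weq)) (trans (split-abs (weightᴹ dS′) (weightᶜ e) (weight d))
           (cong (λ n → suc (weightᴹ dS′ + n) + 0) (sym weq′))))
  -- `mem-pop` types the remaining memory by overwriting the entry at `a` with its tail; after the
  -- push of `ι` this restores `K`.
  ... | eq₁ with terminates (mem-conv (≈ᴹ-reflexive K′≡K) dS′) d′ refl refl (rec (≡suc+⇒< _ 0 eq₁))
    where K′≡K = trans (updateAt-updateAt a K) ([]≔-lookup K a)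
  ... | T , m , j , dT , run , eq′ =
    T , m , _ , dT , ⇓-abs run , trans eq₁ (trans (cong (λ n → suc n + 0) eq′) (step-app m j))

  -- From states with empty continuation to evaluation.

  -- Only `cont-ε` and weightless conversions can type the empty stack.
  ⊢ᴷ-[]⇒≈ : ∀ {v I K} (d : ⊢ᴷ_∶_ {v} [] (I ⇒ K)) → I ≈ᴹ K × weightᴷ d ≡ 0
  ⊢ᴷ-[]⇒≈ cont-ε = ≈ᴹ-refl , refl
  ⊢ᴷ-[]⇒≈ (cont-conv (p ⇒ q) d) with ⊢ᴷ-[]⇒≈ d
  ... | r , eq = ≈ᴹ-trans (≈ᴹ-sym p) (≈ᴹ-trans r q) , eq

  ⊢ˢ-terminates : ∀ {v} {S : Memory v} {M I J} (d : ⊢ˢ (S , M , []) ∶ J ⇒ I) →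
                  Terminates S M I (weightˢ d)
  ⊢ˢ-terminates (state dS d c) with ⊢ᴷ-[]⇒≈ c | terminates dS d refl refl (<-wellFounded _)
  ... | p , c≡0 | T , m , j , (dT , weq) , run , eq =
    T , m , j , (mem-conv p dT , weq) , run ,
    trans (trans (cong (weightᴹ dS + weight d +_) c≡0) (+-identityʳ _)) eq
  ⊢ˢ-terminates (state-conv (_ ⇒ q) d) with ⊢ˢ-terminates d
  ... | T , m , j , (dT , weq) , run , eq = T , m , j , (mem-conv q dT , weq) , run , eq

theorem11 : (k : ℕ) → let open Machine k in
    ∀ {v : ℕ} (S : Memory v) (M : Term v) (I : MemType) (n : ℕ) →
    ⊢ˢ[ n ] (S , M , []) ∶ (ε ⇒ I) →
    Σ[ T ∈ Memory v ] Σ[ m ∈ ℕ ] Σ[ j ∈ ℕ ]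
    ((⊢ᴹ[ m ] T ∶ I) × (S ∣ M ⇓[ j ] T) × (n ≡ m + j))
theorem11 k S M I _ (d , refl) = ⊢ˢ-terminates k d
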